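{- For any TDAG $G$ and any integer $k\geq 2$, $PW(G)\geq k$ if and only if $G_{P(k)}$ is a d-minor of $G$.
   Context: A 2-terminal directed graph $G=\langle V,E,s,t\rangle$ is a directed multigraph without self-loops with distinguished vertices $s,t$ such that every vertex and edge lies on at least one simple directed $s$–$t$ path; a TDAG is such a graph with no directed cycle. A cut is $C\subseteq E$ such that no directed $s$–$t$ path uses only edges of $E\setminus C$; it is minimal if no proper subset is a cut. $S\subseteq E$ is parallel if it is contained in some minimal cut. $PW(G)$ (parallel width) is the maximum size of a parallel set. $G_{P(k)}$ is the graph with two vertices $s,t$ and $k$ parallel edges from $s$ to $t$. d-minors: $G'$ is a d-minor of $G$ if a graph isomorphic to $G'$ is obtained from $G$ by a finite (possibly empty) sequence of: (Deletion) delete an edge $(a,b)$ where $a$ has outdegree $\geq 2$ and $b$ has indegree $\geq 2$; (Backward contraction) contract an edge $(a,b)$ where $b$ has indegree 1; (Forward contraction) contract an edge $(a,b)$ where $a$ has outdegree 1 (contraction merges $a,b$ into one vertex incident to all their other edges). -}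

module Defs where

open import Data.Nat using (ℕ; zero; suc; _≤_)
open import Data.Fin using (Fin) renaming (zero to fz; suc to fs)
open import Data.Fin.Properties using (_≟_)
open import Data.Fin.Subset using (Subset; _∈_; _⊆_; _⊂_; ∣_∣)
open import Data.List using (List; []; _∷_; length; filter)
open import Data.List.Membership.Propositional using () renaming (_∈_ to _∈ₗ_)
open import Data.List.Relation.Unary.Any using (Any)
open import Data.List.Relation.Unary.Unique.Propositional using (Unique)
open import Data.List.Base using (allFin)
open import Data.Product using (Σ; ∃; _×_; _,_; proj₁)
open import Data.Sum using (_⊎_)
open import Relation.Binary.PropositionalEquality using (_≡_; _≢_)
open import Relation.Binary.Construct.Closure.ReflexiveTransitive using (Star)
open import Relation.Nullary using (¬_)
open import Function.Bundles using (_↔_; _⇔_; Inverse)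

record Graph : Set where
  field
    nV nE : ℕ
    src tgt : Fin nE → Fin nV
    s t : Fin nV
open Graph public

module _ (G : Graph) where

  data Walk : Fin (nV G) → Fin (nV G) → Set where
    []  : ∀ {u} → Walk u u
    _∷_ : ∀ {v} (f : Fin (nE G)) → Walk (tgt G f) v → Walk (src G f) v

  edges : ∀ {u v} → Walk u v → List (Fin (nE G))
  edges [] = []
  edges (f ∷ w) = f ∷ edges w

  vertices : ∀ {u v} → Walk u v → List (Fin (nV G))
  vertices {u} [] = u ∷ []
  vertices (f ∷ w) = src G f ∷ vertices w

  IsPath : ∀ {u v} → Walk u v → Set
  IsPath w = Unique (vertices w)

  TwoTerminal : Set
  TwoTerminal =
    (∀ f → src G f ≢ tgt G f) ×
    (∀ x → Σ (Walk (s G) (t G)) λ w → IsPath w × x ∈ₗ vertices w) ×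
    (∀ f → Σ (Walk (s G) (t G)) λ w → IsPath w × f ∈ₗ edges w)

  Acyclic : Set
  Acyclic = ∀ u (w : Walk u u) → edges w ≡ []

  TDAG : Set
  TDAG = TwoTerminal × Acyclic

  IsCut : Subset (nE G) → Set
  IsCut C = ∀ (w : Walk (s G) (t G)) → IsPath w → Any (_∈ C) (edges w)

  IsMinimalCut : Subset (nE G) → Set
  IsMinimalCut C = IsCut C × (∀ D → D ⊂ C → ¬ IsCut D)

  IsParallel : Subset (nE G) → Set
  IsParallel S = ∃ λ C → IsMinimalCut C × S ⊆ C

  -- "PW(G) ≥ k": PW(G) is the maximum size of a parallel set
  PW≥ : ℕ → Set
  PW≥ k = ∃ λ S → IsParallel S × k ≤ ∣ S ∣

  outdeg indeg : Fin (nV G) → ℕ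
  outdeg v = length (filter (λ f → src G f ≟ v) (allFin (nE G)))
  indeg  v = length (filter (λ f → tgt G f ≟ v) (allFin (nE G)))

record Reduct (G H : Graph) (e : Fin (nE G)) (φ : Fin (nV G) → Fin (nV H)) : Set where
  field
    ψ     : (Σ (Fin (nE G)) λ f → f ≢ e) ↔ Fin (nE H)
    src-ψ : ∀ f → src H (Inverse.to ψ f) ≡ φ (src G (proj₁ f))
    tgt-ψ : ∀ f → tgt H (Inverse.to ψ f) ≡ φ (tgt G (proj₁ f))
    s-φ   : φ (s G) ≡ s H
    t-φ   : φ (t G) ≡ t H

Deletion : (G H : Graph) → Fin (nE G) → Set
Deletion G H e = Σ (Fin (nV G) ↔ Fin (nV H)) λ φ → Reduct G H e (Inverse.to φ)

Contraction : (G H : Graph) → Fin (nE G) → Set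
Contraction G H e =
  Σ (Fin (nV G) → Fin (nV H)) λ φ →
    (∀ y → ∃ λ x → φ x ≡ y) ×
    (∀ x y → (φ x ≡ φ y) ⇔ (x ≡ y ⊎ (x ≡ a × y ≡ b) ⊎ (x ≡ b × y ≡ a))) ×
    Reduct G H e φ
  where
  a = src G e
  b = tgt G e

data DStep (G H : Graph) : Set where
  deletion : ∀ e → 2 ≤ outdeg G (src G e) → 2 ≤ indeg G (tgt G e) →
             Deletion G H e → DStep G H
  backward : ∀ e → indeg G (tgt G e) ≡ 1 → Contraction G H e → DStep G H
  forward  : ∀ e → outdeg G (src G e) ≡ 1 → Contraction G H e → DStep G H

record Iso (G H : Graph) : Set where
  field
    φ     : Fin (nV G) ↔ Fin (nV H)
    ψ     : Fin (nE G) ↔ Fin (nE H)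
    src-ψ : ∀ f → src H (Inverse.to ψ f) ≡ Inverse.to φ (src G f)
    tgt-ψ : ∀ f → tgt H (Inverse.to ψ f) ≡ Inverse.to φ (tgt G f)
    s-φ   : Inverse.to φ (s G) ≡ s H
    t-φ   : Inverse.to φ (t G) ≡ t H

DMinor : (G' G : Graph) → Set
DMinor G' G = ∃ λ H → Star DStep G H × Iso H G'

GP : ℕ → Graph
GP k = record
  { nV = 2 ; nE = k
  ; src = λ _ → fz ; tgt = λ _ → fs fz
  ; s = fz ; t = fs fz }

{-# OPTIONS --safe #-}
module Submission where

-- From a d-minor G_P(k) to a parallel set: call k edges separated if some 2-colouring of the
-- vertices makes them cross from the s-side to the t-side, with each tail reachable from s within
-- the s-side and t reachable from each head within the t-side. A separated family pulls back along
-- each reduction step, because a contraction of a → b with indegree 1 at b only identifies a vertex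
-- with the one through which it is necessarily entered. All k edges then lie in every minimal cut
-- contained in the set of crossing edges.
--
-- Conversely, a minimal cut splits the vertices into the part A reached from s, the part B reaching
-- t, and a rest N, with no edges A → N or N → B. While some vertex other than s is not in B, a
-- topologically first one allows a contraction or a deletion that destroys no edge A → B; dually for
-- vertices other than t not in A. In the end only s, t and at least k parallel edges are left.

open import Defs
open import Data.Bool using (Bool; true; false; not)
import Data.Bool.Properties as Bool
open import Data.Fin using (Fin; toℕ; fromℕ<; punchIn; punchOut) renaming (zero to fz; suc to fs)
open import Data.Fin.Induction using (spo-wellFounded)
open import Data.Fin.Properties
  using (_≟_; any?; toℕ-fromℕ<; punchInᵢ≢i; punchIn-punchOut; punchOut-punchIn; injective⇒≤; suc-injective)
open import Data.Fin.Subset using (Subset; _∈_; _∉_; _⊆_; _⊂_; ∣_∣; _-_; inside; outside)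
open import Data.Fin.Subset.Induction using (⊂-wellFounded)
open import Data.Fin.Subset.Properties
  using (_∈?_; _⊂?_; anySubset?; x∈p∧x≢y⇒x∈p-y; x∈p⇒p-x⊂p; x∈p⇒∣p-x∣<∣p∣)
open import Data.List using (List; []; _∷_; length; filter; allFin)
open import Data.List.Membership.Propositional using () renaming (_∈_ to _∈ₗ_)
open import Data.List.Membership.Propositional.Properties using (∈-filter⁺; ∈-filter⁻; ∈-allFin)
open import Data.List.Relation.Unary.All as All using (All; []; _∷_)
open import Data.List.Relation.Unary.All.Properties using (¬Any⇒All¬; All¬⇒¬Any)
open import Data.List.Relation.Unary.AllPairs using ([]; _∷_)
open import Data.List.Relation.Unary.Any as Any using (Any; here; there)
open import Data.List.Relation.Unary.Unique.Propositional using (Unique)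
open import Data.List.Relation.Unary.Unique.Propositional.Properties using (allFin⁺; filter⁺)
open import Data.Nat using (ℕ; zero; suc; _≤_; z≤n; s≤s; _+_)
import Data.Nat.Properties as ℕ
open import Data.Product using (Σ; ∃; _×_; _,_; proj₁; proj₂)
open import Data.Sum using (_⊎_; inj₁; inj₂; [_,_]′)
open import Data.Unit using (⊤; tt)
import Data.Vec as Vec
open import Data.Vec.Properties using (lookup∘tabulate; lookup⇒[]=; []=⇒lookup)
open import Function using (_∘_; id; case_of_)
open import Function.Bundles using (_↔_; _⇔_; Injection; Inverse; Equivalence; mk⇔; mk↔ₛ′)
open import Function.Construct.Identity using (↔-id)
open import Function.Properties.Inverse using (↔⇒↣; ↔-sym)
open import Induction.WellFounded using (Acc; acc)
open import Level using (0ℓ)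
open import Relation.Binary using (Rel; IsStrictPartialOrder)
open import Relation.Binary.Construct.Closure.ReflexiveTransitive
  using (Star; ε; _◅_; _◅◅_; map; reverse)
open import Relation.Binary.PropositionalEquality
  using (_≡_; _≢_; refl; sym; trans; cong; subst; isEquivalence; resp₂)
open import Relation.Nullary using (¬_; Dec; yes; no; contradiction; does)
open import Relation.Nullary.Decidable using (map′; _×-dec_; ¬?; dec-true)
open import Relation.Unary using (Pred; Decidable)

private
  variable
    G H : Graph
    k : ℕ

-- Counting

length≥2 : ∀ {A : Set} {xs : List A} {x y} → x ∈ₗ xs → y ∈ₗ xs → x ≢ y → 2 ≤ length xs
length≥2 (here refl) (here refl) x≢y = contradiction refl x≢y
length≥2 {xs = _ ∷ _ ∷ _} _ _ _ = s≤s (s≤s z≤n)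
length≥2 {xs = _ ∷ []} (there ()) _ _
length≥2 {xs = _ ∷ []} (here _) (there ()) _

module _ {n} {P : Pred (Fin n) 0ℓ} (P? : Decidable P) where

  private
    count : ℕ
    count = length (filter P? (allFin n))

    holds : ∀ {i} → i ∈ₗ filter P? (allFin n) → P i
    holds = proj₂ ∘ ∈-filter⁻ P? {xs = allFin n}

    listed : ∀ {i} → P i → i ∈ₗ filter P? (allFin n)
    listed = ∈-filter⁺ P? (∈-allFin _)

    unique : Unique (filter P? (allFin n))
    unique = filter⁺ P? (allFin⁺ n)

  count≥2 : ∀ {i j} → P i → P j → i ≢ j → 2 ≤ count
  count≥2 Pi Pj = length≥2 (listed Pi) (listed Pj)

  count≡1⇒unique : count ≡ 1 → ∀ {i j} → P i → P j → i ≡ j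
  count≡1⇒unique eq {i} {j} Pi Pj with i ≟ j
  ... | yes i≡j = i≡j
  ... | no  i≢j with s≤s () ← subst (2 ≤_) eq (count≥2 Pi Pj i≢j)

  unique⇒count≡1 : ∀ {i} → P i → (∀ j → P j → j ≡ i) → count ≡ 1
  unique⇒count≡1 Pi only with filter P? (allFin n) | listed Pi | unique | (λ {j} → holds {j})
  ... | _ ∷ []    | _ | _               | _ = refl
  ... | x ∷ y ∷ _ | _ | (x≢y ∷ _) ∷ _ | h =
    contradiction (trans (only x (h (here refl))) (sym (only y (h (there (here refl)))))) x≢y

  count≥2⇒another : 2 ≤ count → ∀ i → ∃ λ j → j ≢ i × P j
  count≥2⇒another 2≤ i with filter P? (allFin n) | unique | (λ {j} → holds {j})
  count≥2⇒another (s≤s ()) i | _ ∷ [] | _ | _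
  ... | x ∷ y ∷ _ | (x≢y ∷ _) ∷ _ | h with x ≟ i
  ...   | no  x≢i  = x , x≢i , h (here refl)
  ...   | yes refl = y , x≢y ∘ sym , h (there (here refl))

injection⇒≤∣p∣ : ∀ {n} (p : Subset n) (ι : Fin k → Fin n) → (∀ {i j} → ι i ≡ ι j → i ≡ j) →
                 (∀ i → ι i ∈ p) → k ≤ ∣ p ∣
injection⇒≤∣p∣ {k = zero}  p ι inj ι∈p = z≤n
injection⇒≤∣p∣ {k = suc k} p ι inj ι∈p = ℕ.≤-trans
  (s≤s (injection⇒≤∣p∣ (p - ι fz) (ι ∘ fs) (suc-injective ∘ inj)
    (λ i → x∈p∧x≢y⇒x∈p-y (ι∈p (fs i)) (λ eq → contradiction (inj eq) λ ()))))
  (x∈p⇒∣p-x∣<∣p∣ (ι∈p fz))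

≤∣p∣⇒injection : ∀ {n} (p : Subset n) → k ≤ ∣ p ∣ →
                 Σ (Fin k → Fin n) λ ι → (∀ {i j} → ι i ≡ ι j → i ≡ j) × (∀ i → ι i ∈ p)
≤∣p∣⇒injection {k = zero} p _ = (λ ()) , (λ {i} → λ { {()} }) , λ ()
≤∣p∣⇒injection {k = suc k} (outside Vec.∷ p) k≤ with ≤∣p∣⇒injection p k≤
... | ι , inj , ι∈p = fs ∘ ι , inj ∘ suc-injective , Vec.there ∘ ι∈p
≤∣p∣⇒injection {k = suc k} {suc n} (inside Vec.∷ p) (s≤s k≤) with ≤∣p∣⇒injection p k≤
... | ι , inj , ι∈p = ι′ , inj′ _ _ , ι′∈p
  where
  ι′ : Fin (suc k) → Fin (suc n)
  ι′ fz     = fz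
  ι′ (fs i) = fs (ι i)
  inj′ : ∀ i j → ι′ i ≡ ι′ j → i ≡ j
  inj′ fz     fz     _  = refl
  inj′ (fs i) (fs j) eq = cong fs (inj (suc-injective eq))
  ι′∈p : ∀ i → ι′ i ∈ inside Vec.∷ p
  ι′∈p fz     = Vec.here
  ι′∈p (fs i) = Vec.there (ι∈p i)

-- Reachability and duality

-- Endpoints are constrained by equations, so that reversing a walk in the dual graph only swaps two
-- proofs.
Reach : (G : Graph) → Pred (Fin (nE G)) 0ℓ → Rel (Fin (nV G)) 0ℓ
Reach G P = Star λ u v → ∃ λ f → P f × src G f ≡ u × tgt G f ≡ v

Inside : (G : Graph) → Pred (Fin (nV G)) 0ℓ → Pred (Fin (nE G)) 0ℓ
Inside G Q f = Q (src G f) × Q (tgt G f)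

-- Phrased through `Inside`, so that `lift` with the always true predicate produces such walks
-- directly.
Anywhere : (G : Graph) → Pred (Fin (nE G)) 0ℓ
Anywhere G = Inside G (λ _ → ⊤)

reach-map : ∀ {P P′ : Pred (Fin (nE G)) 0ℓ} → (∀ {f} → P f → P′ f) →
            ∀ {u v} → Reach G P u v → Reach G P′ u v
reach-map P⇒P′ = map λ (f , p , eqs) → f , P⇒P′ p , eqs

op : Graph → Graph
op G = record { nV = nV G ; nE = nE G ; src = tgt G ; tgt = src G ; s = t G ; t = s G }

op-reach : ∀ {P : Pred (Fin (nE G)) 0ℓ} {P′} → (∀ {f} → P f → P′ f) →
           ∀ {u v} → Reach G P u v → Reach (op G) P′ v u
op-reach P⇒P′ = reverse λ (f , p , eq , eq′) → f , P⇒P′ p , eq′ , eq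

-- The working form of being a TDAG: symmetric under `op`, preserved by every reduction step, and
-- local apart from acyclicity.
record Proper (G : Graph) : Set where
  field
    acyclic  : ∀ f → ¬ Reach G (Anywhere G) (tgt G f) (src G f)
    in-edge  : ∀ v → v ≢ s G → ∃ λ f → tgt G f ≡ v
    out-edge : ∀ v → v ≢ t G → ∃ λ f → src G f ≡ v

op-proper : Proper G → Proper (op G)
op-proper {G} p = record
  { acyclic  = λ f w → acyclic f (op-reach {op G} (λ _ → tt , tt) w)
  ; in-edge  = out-edge
  ; out-edge = in-edge }
  where open Proper p

-- Induction along edges

module _ (p : Proper G) where
  open Proper p

  private
    _⊏_ : Rel (Fin (nV G)) 0ℓ
    u ⊏ v = ∃ λ f → src G f ≡ u × Reach G (Anywhere G) (tgt G f) v

    ⊏-isStrictPartialOrder : IsStrictPartialOrder _≡_ _⊏_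
    ⊏-isStrictPartialOrder = record
      { isEquivalence = isEquivalence
      ; irrefl        = λ { refl (f , refl , w) → acyclic f w }
      ; trans         = λ { (f , eq , w) (g , refl , w′) →
                            f , eq , w ◅◅ (g , (tt , tt) , refl , refl) ◅ w′ }
      ; <-resp-≈      = resp₂ _⊏_ }

  -- Acyclicity makes `⊏` a strict partial order, and on a finite set every such order is
  -- well-founded.
  edge-rec : ∀ {P : Pred (Fin (nV G)) 0ℓ} →
             (∀ v → (∀ f → tgt G f ≡ v → P (src G f)) → P v) → ∀ v → P v
  edge-rec {P} step v = go v (spo-wellFounded ⊏-isStrictPartialOrder v)
    where
    go : ∀ v → Acc _⊏_ v → P v
    go v (acc rs) = step v λ { f refl → go (src G f) (rs (f , refl , ε)) }

  source-reaches : ∀ v → Reach G (Anywhere G) (s G) v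
  source-reaches = edge-rec λ v rec → case v rec
    where
    case : ∀ v → (∀ f → tgt G f ≡ v → Reach G (Anywhere G) (s G) (src G f)) →
           Reach G (Anywhere G) (s G) v
    case v rec with v ≟ s G
    ... | yes refl = ε
    ... | no  v≢s with in-edge v v≢s
    ...   | f , eq = rec f eq ◅◅ (f , (tt , tt) , refl , eq) ◅ ε

  -- The tail of such an edge is reachable from `s`, so the edge would close a cycle.
  no-edge-into-source : ∀ f → tgt G f ≢ s G
  no-edge-into-source f eq =
    acyclic f (subst (λ v → Reach G _ v (src G f)) (sym eq) (source-reaches (src G f)))

  no-loop : ∀ f → src G f ≢ tgt G f
  no-loop f eq = acyclic f (subst (Reach G _ (tgt G f)) (sym eq) ε)

  minimal : ∀ {P : Pred (Fin (nV G)) 0ℓ} → Decidable P → ∀ v → P v →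
            ∃ λ v → P v × (∀ f → tgt G f ≡ v → ¬ P (src G f))
  minimal {P} P? = edge-rec λ v rec Pv → case v rec Pv
    where
    case : ∀ v → (∀ f → tgt G f ≡ v → P (src G f) → _) → P v → _
    case v rec Pv with any? (λ f → (tgt G f ≟ v) ×-dec P? (src G f))
    ... | yes (f , eq , Pf) = rec f eq Pf
    ... | no  none          = v , Pv , λ f eq Pf → none (f , eq , Pf)

no-edge-from-sink : Proper G → ∀ f → src G f ≢ t G
no-edge-from-sink p = no-edge-into-source (op-proper p)

-- The search forward from `u` terminates by acyclicity: it is induction along the edges of the
-- dual.
reach? : Proper G → ∀ {P} → Decidable P → ∀ u v → Dec (Reach G P u v)
reach? {G} p {P} P? u v = edge-rec (op-proper p) {λ u → Dec (Reach G P u v)} step u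
  where
  step : ∀ u → (∀ f → src G f ≡ u → Dec (Reach G P (tgt G f) v)) → Dec (Reach G P u v)
  step u rec with u ≟ v
  ... | yes refl = yes ε
  ... | no  u≢v = map′
    (λ (f , Pf , eq , w) → (f , Pf , eq , refl) ◅ w)
    (λ { ε → contradiction refl u≢v
       ; ((f , Pf , eq , refl) ◅ w) → f , Pf , eq , w })
    (any? through)
    where
    through : ∀ f → Dec (P f × src G f ≡ u × Reach G P (tgt G f) v)
    through f with src G f ≟ u
    ... | no  ≢u = no (≢u ∘ proj₁ ∘ proj₂)
    ... | yes eq = P? f ×-dec (yes eq ×-dec rec f eq)

-- Walks and cuts

toWalk : ∀ {P u v} → Reach G P u v → Σ (Walk G u v) λ w → All P (edges G w)
toWalk ε = [] , []
toWalk ((f , Pf , refl , refl) ◅ r) with toWalk r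
... | w , all = f ∷ w , Pf ∷ all

fromWalk : ∀ {P u v} (w : Walk G u v) → All P (edges G w) → Reach G P u v
fromWalk []      []         = ε
fromWalk (f ∷ w) (Pf ∷ all) = (f , Pf , refl , refl) ◅ fromWalk w all

prefix : ∀ {u v x} (w : Walk G u v) → x ∈ₗ vertices G w → Reach G (Anywhere G) u x
prefix []      (here refl) = ε
prefix (f ∷ w) (here refl) = ε
prefix (f ∷ w) (there x∈w) = (f , _ , refl , refl) ◅ prefix w x∈w

-- A repeated vertex would close a cycle. This turns `IsCut` into a statement about `Reach`.
isPath : Proper G → ∀ {u v} (w : Walk G u v) → IsPath G w
isPath p []      = [] ∷ []
isPath p (f ∷ w) =
  All.tabulate (λ { x∈w refl → Proper.acyclic p f (prefix w x∈w) }) ∷ isPath p w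

isCut⇒¬reach : Proper G → ∀ {C} → IsCut G C → ¬ Reach G (_∉ C) (s G) (t G)
isCut⇒¬reach p cut r with toWalk r
... | w , avoid = All¬⇒¬Any avoid (cut w (isPath p w))

¬reach⇒isCut : ∀ {C} → ¬ Reach G (_∉ C) (s G) (t G) → IsCut G C
¬reach⇒isCut {G} {C} ¬r w _ with Any.any? (_∈? C) (edges G w)
... | yes any = any
... | no ¬any = contradiction (fromWalk w (¬Any⇒All¬ _ ¬any)) ¬r

avoiding? : Proper G → ∀ C u v → Dec (Reach G (_∉ C) u v)
avoiding? p C = reach? p (λ f → ¬? (f ∈? C))

isCut? : Proper G → ∀ C → Dec (IsCut G C)
isCut? p C with avoiding? p C _ _
... | yes r = no (λ cut → isCut⇒¬reach p cut r)
... | no ¬r = yes (¬reach⇒isCut ¬r)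

-- Descent along strict inclusion; since `IsCut` is decidable and subsets are finite in number, the
-- existence of a smaller cut can be decided.
minimalCut : Proper G → ∀ C → IsCut G C → ∃ λ D → IsMinimalCut G D × D ⊆ C
minimalCut {G} p C = go C (⊂-wellFounded C)
  where
  go : ∀ C → Acc _⊂_ C → IsCut G C → ∃ λ D → IsMinimalCut G D × D ⊆ C
  go C (acc rs) cut with anySubset? (λ D → (D ⊂? C) ×-dec isCut? p D)
  ... | no  none = C , (cut , λ D D⊂C cutD → none (D , D⊂C , cutD)) , id
  ... | yes (D , D⊂C , cutD) with go D (rs D⊂C) cutD
  ...   | E , min , E⊆D = E , min , λ x → proj₁ D⊂C (E⊆D x)

TDAG⇒proper : TDAG G → Proper G
TDAG⇒proper {G} ((_ , onPath , _) , acyc) = record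
  { acyclic  = nonempty
  ; in-edge  = λ v v≢s → let (w , _ , v∈w) = onPath v in entered w v∈w v≢s
  ; out-edge = λ v v≢t → let (w , _ , v∈w) = onPath v in left w v∈w v≢t }
  where
  nonempty : ∀ f → ¬ Reach G (Anywhere G) (tgt G f) (src G f)
  nonempty f r with acyc _ (f ∷ proj₁ (toWalk r))
  ... | ()
  entered : ∀ {u v x} (w : Walk G u v) → x ∈ₗ vertices G w → x ≢ u → ∃ λ f → tgt G f ≡ x
  entered []      (here refl) x≢u = contradiction refl x≢u
  entered (f ∷ w) (here refl) x≢u = contradiction refl x≢u
  entered {x = x} (f ∷ w) (there x∈w) x≢u with tgt G f ≟ x
  ... | yes eq = f , eq
  ... | no ≢x  = entered w x∈w (≢x ∘ sym)
  left : ∀ {u v x} (w : Walk G u v) → x ∈ₗ vertices G w → x ≢ v → ∃ λ f → src G f ≡ x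
  left []      (here refl) x≢v = contradiction refl x≢v
  left (f ∷ w) (here refl) x≢v = f , refl
  left (f ∷ w) (there x∈w) x≢v = left w x∈w x≢v

-- Reductions

op-reduct : ∀ {e φ} → Reduct G H e φ → Reduct (op G) (op H) e φ
op-reduct r = record { ψ = ψ ; src-ψ = tgt-ψ ; tgt-ψ = src-ψ ; s-φ = t-φ ; t-φ = s-φ }
  where open Reduct r

op-contraction : ∀ {e} → Contraction G H e → Contraction (op G) (op H) e
op-contraction (φ , surj , ker , r) = φ , surj ,
  (λ x y → mk⇔ (swap ∘ Equivalence.to (ker x y)) (Equivalence.from (ker x y) ∘ swap)) ,
  op-reduct r
  where
  swap : ∀ {A B C : Set} → A ⊎ B ⊎ C → A ⊎ C ⊎ B
  swap (inj₁ a)        = inj₁ a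
  swap (inj₂ (inj₁ b)) = inj₂ (inj₂ b)
  swap (inj₂ (inj₂ c)) = inj₂ (inj₁ c)

op-step : DStep G H → DStep (op G) (op H)
op-step (deletion e 2≤out 2≤in (φ , r)) = deletion e 2≤in 2≤out (φ , op-reduct r)
op-step (backward e in≡1 c)  = forward e in≡1 (op-contraction c)
op-step (forward  e out≡1 c) = backward e out≡1 (op-contraction c)

module _ {e φ} (r : Reduct G H e φ) where
  open Reduct r

  new : ∀ f → f ≢ e → Fin (nE H)
  new f f≢e = Inverse.to ψ (f , f≢e)

  old : Fin (nE H) → Fin (nE G)
  old h = proj₁ (Inverse.from ψ h)

  old≢e : ∀ h → old h ≢ e
  old≢e h = proj₂ (Inverse.from ψ h)

  old-injective : ∀ {h h′} → old h ≡ old h′ → h ≡ h′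
  old-injective {h} {h′} eq = trans (sym (Inverse.strictlyInverseˡ ψ h))
    (trans (to-cong (old≢e h) (old≢e h′) eq) (Inverse.strictlyInverseˡ ψ h′))
    where
    to-cong : ∀ {f g} (p : f ≢ e) (q : g ≢ e) → f ≡ g → new f p ≡ new g q
    -- `p` and `q` are definitionally equal, as all elements of the empty type are.
    to-cong p q refl = refl

  new-injective : ∀ {f g} (p : f ≢ e) (q : g ≢ e) → new f p ≡ new g q → f ≡ g
  new-injective p q eq = cong proj₁ (Injection.injective (↔⇒↣ ψ) eq)

  src-old : ∀ h → src H h ≡ φ (src G (old h))
  src-old h = trans (cong (src H) (sym (Inverse.strictlyInverseˡ ψ h))) (src-ψ _)

  tgt-old : ∀ h → tgt H h ≡ φ (tgt G (old h))
  tgt-old h = trans (cong (tgt H) (sym (Inverse.strictlyInverseˡ ψ h))) (tgt-ψ _)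

-- Walks of H can be lifted to G from any start satisfying Good: two vertices identified by φ
-- are joined in the right direction.
record Lifting (G H : Graph) : Set₁ where
  field
    {e}      : Fin (nE G)
    {φ}      : Fin (nV G) → Fin (nV H)
    reduct   : Reduct G H e φ
    Good     : Pred (Fin (nV G)) 0ℓ
    good-s   : Good (s G)
    good-tgt : ∀ f → f ≢ e → Good (tgt G f)
    link     : ∀ (Q : Pred (Fin (nV H)) 0ℓ) {u x} → Good u → Q (φ u) → φ u ≡ φ x →
               Reach G (Inside G (Q ∘ φ)) u x

  -- Before each edge, `link` moves from the current vertex to the actual tail of that edge in `G`;
  -- the head of the edge is `Good` again, so the walk can continue.
  lift : ∀ Q {y y′} → Reach H (Inside H Q) y y′ → ∀ {u v} → Good u → Q y → y ≡ φ u → y′ ≡ φ v →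
         Reach G (Inside G (Q ∘ φ)) u v
  lift Q ε good q refl eq = link Q good q eq
  lift Q ((h , (q , q′) , refl , refl) ◅ w) good _ eq eq′ =
    link Q good (subst Q eq q) (trans (sym eq) (src-old reduct h)) ◅◅
    (old reduct h , (subst Q (src-old reduct h) q , subst Q (tgt-old reduct h) q′) , refl , refl) ◅
    lift Q w (good-tgt _ (old≢e reduct h)) q′ (tgt-old reduct h) eq′

  acyclic-lift : Proper G → ∀ h → ¬ Reach H (Anywhere H) (tgt H h) (src H h)
  acyclic-lift p h w = Proper.acyclic p (old reduct h)
    (lift (λ _ → ⊤) w (good-tgt _ (old≢e reduct h)) tt (tgt-old reduct h) (src-old reduct h))

deletion-lifting : ∀ {e} → Deletion G H e → Lifting G H
deletion-lifting {G} (φ , r) = record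
  { reduct = r ; Good = λ _ → ⊤ ; good-s = tt ; good-tgt = λ _ _ → tt
  ; link = λ Q {u} _ _ eq → subst (Reach G _ u) (Injection.injective (↔⇒↣ φ) eq) ε }

-- `e` is the only edge into its head, so no surviving edge ends there. A lifted walk entering the
-- merged vertex arrives at the tail of `e` and, if it must leave from the head, passes through `e`.
backward-lifting : Proper G → ∀ e → indeg G (tgt G e) ≡ 1 → Contraction G H e → Lifting G H
backward-lifting {G} p e in≡1 (φ , surj , ker , r) = record
  { reduct   = r
  ; Good     = _≢ tgt G e
  ; good-s   = no-edge-into-source p e ∘ sym
  ; good-tgt = λ f f≢e eq → f≢e (count≡1⇒unique (λ f → tgt G f ≟ tgt G e) in≡1 eq refl)
  ; link     = link }
  where
  link : ∀ Q {u x} → u ≢ tgt G e → Q (φ u) → φ u ≡ φ x → Reach G (Inside G (Q ∘ φ)) u x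
  link Q {u} {x} u≢b q eq with Equivalence.to (ker u x) eq
  ... | inj₁ refl                 = ε
  ... | inj₂ (inj₁ (refl , refl)) = (e , (q , subst Q eq q) , refl , refl) ◅ ε
  ... | inj₂ (inj₂ (u≡b , _))     = contradiction u≡b u≢b

-- If the in-edge found in `G` is `e` itself, the degree condition supplies another.
deletion-in-edge : Proper G → ∀ e → 2 ≤ indeg G (tgt G e) → Deletion G H e →
                   ∀ y → y ≢ s H → ∃ λ h → tgt H h ≡ y
deletion-in-edge {G} {H} p e 2≤in (φ , r) y y≢s with Inverse.from φ y | Inverse.strictlyInverseˡ φ y
... | x | refl with Proper.in-edge p x (λ { refl → y≢s (Reduct.s-φ r) })
...   | f , refl with f ≟ e
...     | no f≢e = new r f f≢e , Reduct.tgt-ψ r _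
...     | yes refl with count≥2⇒another (λ f → tgt G f ≟ tgt G e) 2≤in e
...       | g , g≢e , eq = new r g g≢e , trans (Reduct.tgt-ψ r _) (cong (Inverse.to φ) eq)

-- If the in-edge found is `e`, an in-edge of its tail serves instead. The tail is not `s`, for
-- otherwise the merged vertex would be `s H`.
contraction-in-edge : Proper G → ∀ e → Contraction G H e → ∀ y → y ≢ s H → ∃ λ h → tgt H h ≡ y
contraction-in-edge {G} {H} p e (φ , surj , ker , r) y y≢s with surj y
... | x , refl with Proper.in-edge p x (λ { refl → y≢s (Reduct.s-φ r) })
...   | f , refl with f ≟ e
...     | no f≢e = new r f f≢e , Reduct.tgt-ψ r _
...     | yes refl = case
  where
  merged : φ (src G e) ≡ φ (tgt G e)
  merged = Equivalence.from (ker _ _) (inj₂ (inj₁ (refl , refl)))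
  case : ∃ λ h → tgt H h ≡ φ (tgt G e)
  case with Proper.in-edge p (src G e)
              (λ eq → y≢s (trans (sym merged) (trans (cong φ eq) (Reduct.s-φ r))))
  ... | g , eq = new r g (λ { refl → no-loop p e (sym eq) }) ,
                 trans (Reduct.tgt-ψ r _) (trans (cong φ eq) merged)

backward-proper : Proper G → ∀ e → indeg G (tgt G e) ≡ 1 → Contraction G H e → Proper H
backward-proper p e in≡1 c = record
  { acyclic  = Lifting.acyclic-lift (backward-lifting p e in≡1 c) p
  ; in-edge  = contraction-in-edge p e c
  ; out-edge = contraction-in-edge (op-proper p) e (op-contraction c) }

step-proper : DStep G H → Proper G → Proper H
step-proper (deletion e 2≤out 2≤in d@(φ , r)) p = record
  { acyclic  = Lifting.acyclic-lift (deletion-lifting d) p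
  ; in-edge  = deletion-in-edge p e 2≤in d
  ; out-edge = deletion-in-edge (op-proper p) e 2≤out (φ , op-reduct r) }
step-proper (backward e in≡1 c)  p = backward-proper p e in≡1 c
step-proper (forward  e out≡1 c) p =
  op-proper (backward-proper (op-proper p) e out≡1 (op-contraction c))

-- d-minors bound the parallel width from below

-- Both families of walks are confined by a vertex predicate, the form of reachability that `lift`
-- transports.
record Separated (G : Graph) (k : ℕ) : Set where
  field
    χ           : Fin (nV G) → Bool
    χ-s         : χ (s G) ≡ true
    χ-t         : χ (t G) ≡ false
    ι           : Fin k → Fin (nE G)
    ι-injective : ∀ {i j} → ι i ≡ ι j → i ≡ j
    χ-src       : ∀ i → χ (src G (ι i)) ≡ true
    χ-tgt       : ∀ i → χ (tgt G (ι i)) ≡ false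
    from-s      : ∀ i → Reach G (Inside G (λ v → χ v ≡ true)) (s G) (src G (ι i))
    to-t        : ∀ i → Reach G (Inside G (λ v → χ v ≡ false)) (tgt G (ι i)) (t G)

op-separated : Separated G k → Separated (op G) k
op-separated {G} S = record
  { χ = not ∘ χ ; χ-s = cong not χ-t ; χ-t = cong not χ-s
  ; ι = ι ; ι-injective = ι-injective
  ; χ-src = cong not ∘ χ-tgt ; χ-tgt = cong not ∘ χ-src
  ; from-s = op-reach {G} (λ (a , b) → cong not b , cong not a) ∘ to-t
  ; to-t = op-reach {G} (λ (a , b) → cong not b , cong not a) ∘ from-s }
  where open Separated S

-- The colouring pulls back along `φ`. The walks start where lifting is possible: at `s`, or at the
-- head of a surviving edge.
lift-separated : Lifting G H → Separated H k → Separated G k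
lift-separated {G} {H} L S = record
  { χ = χ ∘ φ ; χ-s = trans (cong χ s-φ) χ-s ; χ-t = trans (cong χ t-φ) χ-t
  ; ι = old reduct ∘ ι ; ι-injective = ι-injective ∘ old-injective reduct
  ; χ-src = λ i → trans (cong χ (sym (src-old reduct (ι i)))) (χ-src i)
  ; χ-tgt = λ i → trans (cong χ (sym (tgt-old reduct (ι i)))) (χ-tgt i)
  ; from-s = λ i → lift (λ v → χ v ≡ true) (from-s i) good-s χ-s (sym s-φ) (src-old reduct (ι i))
  ; to-t = λ i → lift (λ v → χ v ≡ false) (to-t i) (good-tgt _ (old≢e reduct (ι i))) (χ-tgt i)
                   (tgt-old reduct (ι i)) (sym t-φ) }
  where
  open Separated S
  open Lifting L
  open Reduct reduct using (s-φ; t-φ)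

step-separated : DStep G H → Proper G → Separated H k → Separated G k
step-separated (deletion e _ _ d)   p = lift-separated (deletion-lifting d)
step-separated (backward e in≡1 c)  p = lift-separated (backward-lifting p e in≡1 c)
step-separated (forward  e out≡1 c) p = op-separated ∘
  lift-separated (backward-lifting (op-proper p) e out≡1 (op-contraction c)) ∘ op-separated

iso-separated : Iso H (GP k) → Separated H k
iso-separated {H} {k} iso = record
  { χ = isZero ∘ Inverse.to φ
  ; χ-s = cong isZero s-φ ; χ-t = cong isZero t-φ
  ; ι = Inverse.from ψ
  ; ι-injective = Injection.injective (↔⇒↣ (↔-sym ψ))
  ; χ-src = λ i → cong isZero (sym (src-ψ _)) ; χ-tgt = λ i → cong isZero (sym (tgt-ψ _))
  ; from-s = λ i → subst (Reach H _ _) (inj (trans s-φ (src-ψ _))) ε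
  ; to-t = λ i → subst (Reach H _ _) (inj (trans (sym (tgt-ψ _)) (sym t-φ))) ε }
  where
  open Iso iso
  isZero : Fin 2 → Bool
  isZero fz     = true
  isZero (fs _) = false
  inj : ∀ {x y} → Inverse.to φ x ≡ Inverse.to φ y → x ≡ y
  inj = Injection.injective (↔⇒↣ φ)

-- Properness travels forward along the reduction sequence, separation backward.
minor-separated : Proper G → DMinor (GP k) G → Separated G k
minor-separated p (H , steps , iso) = go p steps iso
  where
  go : Proper G → Star DStep G H → Iso H (GP k) → Separated G k
  go p ε            iso = iso-separated iso
  go p (st ◅ steps) iso = step-separated st p (go (step-proper st p) steps iso)

-- From separated edges to a minimal cut

module _ (p : Proper G) (S : Separated G k) where
  open Separated S

  private
    Crossing? : Decidable λ f → χ (src G f) ≡ true × χ (tgt G f) ≡ false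
    Crossing? f = (χ (src G f) Bool.≟ true) ×-dec (χ (tgt G f) Bool.≟ false)

    C : Subset (nE G)
    C = Vec.tabulate (does ∘ Crossing?)

    crossing⇒∈C : ∀ {f} → χ (src G f) ≡ true × χ (tgt G f) ≡ false → f ∈ C
    crossing⇒∈C {f} c = lookup⇒[]= f C (trans (lookup∘tabulate _ f) (dec-true (Crossing? f) c))

    ∈C⇒crossing : ∀ {f} → f ∈ C → χ (src G f) ≡ true × χ (tgt G f) ≡ false
    ∈C⇒crossing {f} f∈C = does≡true⇒
      (Crossing? f) (trans (sym (lookup∘tabulate (does ∘ Crossing?) f)) ([]=⇒lookup f∈C))
      where
      does≡true⇒ : ∀ {A : Set} (a? : Dec A) → does a? ≡ true → A
      does≡true⇒ (yes a) _ = a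

    stuck : ∀ {u v} → Reach G (_∉ C) u v → χ u ≡ true → χ v ≡ true
    stuck ε χu = χu
    stuck ((f , f∉C , refl , refl) ◅ w) χu with χ (tgt G f) in eq
    ... | true  = stuck w eq
    ... | false = contradiction (crossing⇒∈C (χu , eq)) f∉C

    C-cut : IsCut G C
    C-cut = ¬reach⇒isCut λ w → contradiction (trans (sym χ-t) (stuck w χ-s)) λ ()

    ∉-if-true : ∀ {D f} → D ⊆ C → χ (tgt G f) ≡ true → f ∉ D
    ∉-if-true D⊆C eq f∈D = contradiction (trans (sym eq) (proj₂ (∈C⇒crossing (D⊆C f∈D)))) λ ()

    ∉-if-false : ∀ {D f} → D ⊆ C → χ (src G f) ≡ false → f ∉ D
    ∉-if-false D⊆C eq f∈D = contradiction (trans (sym eq) (proj₁ (∈C⇒crossing (D⊆C f∈D)))) λ ()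

  -- `C` consists of all crossing edges and contains a minimal cut `D`. If `D` missed `ι i`, the two
  -- one-coloured walks joined by `ι i` would avoid `D`, because none of their edges crosses.
  separated⇒PW≥ : PW≥ G k
  separated⇒PW≥ with minimalCut p C C-cut
  ... | D , min , D⊆C = D , (D , min , id) , injection⇒≤∣p∣ D ι ι-injective ι∈D
    where
    ι∈D : ∀ i → ι i ∈ D
    ι∈D i with ι i ∈? D
    ... | yes ∈D = ∈D
    ... | no  ∉D = contradiction
      (reach-map {G} (λ (_ , b) → ∉-if-true D⊆C b) (from-s i) ◅◅
       (ι i , ∉D , refl , refl) ◅ reach-map {G} (λ (a , _) → ∉-if-false D⊆C a) (to-t i))
      (isCut⇒¬reach p (proj₁ min))

-- Parallel sets yield d-minors

-- The sides of a minimal cut C: A is reachable from s, and B reaches t, avoiding C; N is the rest.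
data Side : Set where
  A N B : Side

flip-side : Side → Side
flip-side A = B
flip-side N = N
flip-side B = A

flip-side-B : ∀ {x} → flip-side x ≡ B → x ≡ A
flip-side-B {A} _ = refl

_≟ˢ_ : (x y : Side) → Dec (x ≡ y)
A ≟ˢ A = yes refl
A ≟ˢ N = no λ ()
A ≟ˢ B = no λ ()
N ≟ˢ A = no λ ()
N ≟ˢ N = yes refl
N ≟ˢ B = no λ ()
B ≟ˢ A = no λ ()
B ≟ˢ N = no λ ()
B ≟ˢ B = yes refl

-- `A-pred` and `B-succ` replace walks inside A and B by single edges, so that a reduction only has
-- to repair the witnesses it destroys. Edges out of B or into A are unrestricted.
record Coloured (G : Graph) (k : ℕ) : Set where
  field
    c           : Fin (nV G) → Side
    c-s         : c (s G) ≡ A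
    c-t         : c (t G) ≡ B
    A-pred      : ∀ v → c v ≡ A → v ≢ s G → ∃ λ f → tgt G f ≡ v × c (src G f) ≡ A
    B-succ      : ∀ v → c v ≡ B → v ≢ t G → ∃ λ f → src G f ≡ v × c (tgt G f) ≡ B
    ¬A→N        : ∀ f → c (src G f) ≡ A → c (tgt G f) ≢ N
    ¬N→B        : ∀ f → c (tgt G f) ≡ B → c (src G f) ≢ N
    ι           : Fin k → Fin (nE G)
    ι-injective : ∀ {i j} → ι i ≡ ι j → i ≡ j
    ι-src       : ∀ i → c (src G (ι i)) ≡ A
    ι-tgt       : ∀ i → c (tgt G (ι i)) ≡ B

op-coloured : Coloured G k → Coloured (op G) k
op-coloured {G} C = record
  { c = flip-side ∘ c ; c-s = cong flip-side c-t ; c-t = cong flip-side c-s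
  ; A-pred = λ v eq v≢t → let (f , p , q) = B-succ v (B← eq) v≢t in f , p , cong flip-side q
  ; B-succ = λ v eq v≢s → let (f , p , q) = A-pred v (flip-side-B eq) v≢s in f , p , cong flip-side q
  ; ¬A→N = λ f eq eq′ → ¬N→B f (B← eq) (N← eq′)
  ; ¬N→B = λ f eq eq′ → ¬A→N f (flip-side-B eq) (N← eq′)
  ; ι = ι ; ι-injective = ι-injective
  ; ι-src = cong flip-side ∘ ι-tgt ; ι-tgt = cong flip-side ∘ ι-src }
  where
  open Coloured C
  B← : ∀ {x} → flip-side x ≡ A → x ≡ B
  B← {B} _ = refl
  N← : ∀ {x} → flip-side x ≡ N → x ≡ N
  N← {N} _ = refl

-- The colouring given by a minimal cut

module _ (p : Proper G) {C : Subset (nE G)} (min : IsMinimalCut G C) where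

  private
    separates : ¬ Reach G (_∉ C) (s G) (t G)
    separates = isCut⇒¬reach p (proj₁ min)

    -- If the walk uses `f`, the two pieces are what precedes the first use and what follows the
    -- last.
    split : ∀ f {u v} → Reach G (_∉ C - f) u v →
            Reach G (_∉ C) u v ⊎ (Reach G (_∉ C) u (src G f) × Reach G (_∉ C) (tgt G f) v)
    split f ε = inj₁ ε
    split f ((g , g∉ , refl , refl) ◅ w) with g ≟ f | split f w
    ... | yes refl | inj₁ w′        = inj₂ (ε , w′)
    ... | yes refl | inj₂ (_ , w′)  = inj₂ (ε , w′)
    ... | no  g≢f  | inj₁ w′        = inj₁ ((g , g∉C , refl , refl) ◅ w′)
      where
      g∉C : g ∉ C
      g∉C g∈C = g∉ (x∈p∧x≢y⇒x∈p-y g∈C g≢f)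
    ... | no  g≢f  | inj₂ (w′ , w″) = inj₂ ((g , g∉C , refl , refl) ◅ w′ , w″)
      where
      g∉C : g ∉ C
      g∉C g∈C = g∉ (x∈p∧x≢y⇒x∈p-y g∈C g≢f)

    -- By minimality `C - f` is not a cut, so some walk from `s` to `t` avoids it; as `C` is a cut,
    -- this walk uses `f`.
    cut-edge : ∀ {f} → f ∈ C → Reach G (_∉ C) (s G) (src G f) × Reach G (_∉ C) (tgt G f) (t G)
    cut-edge {f} f∈C with avoiding? p (C - f) (s G) (t G)
    ... | no ¬w = contradiction (¬reach⇒isCut ¬w) (proj₂ min (C - f) (x∈p⇒p-x⊂p f∈C))
    ... | yes w with split f w
    ...   | inj₁ w′ = contradiction w′ separates
    ...   | inj₂ ws = ws

    side : ∀ v → Σ Side λ where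
      A → Reach G (_∉ C) (s G) v
      N → ¬ Reach G (_∉ C) (s G) v × ¬ Reach G (_∉ C) v (t G)
      B → Reach G (_∉ C) v (t G)
    side v with avoiding? p C (s G) v | avoiding? p C v (t G)
    ... | yes w | _     = A , w
    ... | no ¬w | yes w = B , w
    ... | no ¬w | no ¬w′ = N , ¬w , ¬w′

    c : Fin (nV G) → Side
    c = proj₁ ∘ side

    from-A : ∀ {v} → c v ≡ A → Reach G (_∉ C) (s G) v
    from-A {v} eq with side v
    from-A refl | A , w = w

    from-B : ∀ {v} → c v ≡ B → Reach G (_∉ C) v (t G)
    from-B {v} eq with side v
    from-B refl | B , w = w

    to-A : ∀ {v} → Reach G (_∉ C) (s G) v → c v ≡ A
    to-A {v} w with side v
    ... | A , _        = refl
    ... | N , ¬w , _   = contradiction w ¬w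
    ... | B , w′       = contradiction (w ◅◅ w′) separates

    to-B : ∀ {v} → Reach G (_∉ C) v (t G) → c v ≡ B
    to-B {v} w with side v
    ... | A , w′       = contradiction (w′ ◅◅ w) separates
    ... | N , _ , ¬w   = contradiction w ¬w
    ... | B , _        = refl

    last-edge : ∀ {P u v} → Reach G P u v → v ≢ u →
                ∃ λ f → tgt G f ≡ v × Reach G P u (src G f)
    last-edge ε v≢u = contradiction refl v≢u
    last-edge {v = v} ((f , pf , refl , refl) ◅ w) v≢u with v ≟ tgt G f
    ... | yes eq = f , sym eq , ε
    ... | no  v≢ with last-edge w v≢
    ...   | g , eq , w′ = g , eq , (f , pf , refl , refl) ◅ w′

    first-edge : ∀ {P u v} → Reach G P u v → u ≢ v →
                 ∃ λ f → src G f ≡ u × Reach G P (tgt G f) v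
    first-edge ε u≢v = contradiction refl u≢v
    first-edge ((f , _ , eq , refl) ◅ w) _ = f , eq , w

    distinct : ∀ {x y z : Side} → y ≢ z → x ≡ y → x ≢ z
    distinct y≢z refl = y≢z

  parallel⇒coloured : ∀ {S} → S ⊆ C → k ≤ ∣ S ∣ → Coloured G k
  parallel⇒coloured {S = S} S⊆C k≤ with ≤∣p∣⇒injection S k≤
  ... | ι , inj , ι∈S = record
    { c = c ; c-s = to-A ε ; c-t = to-B ε
    ; A-pred = λ v eq v≢s → let (f , eq′ , w) = last-edge (from-A eq) v≢s in f , eq′ , to-A w
    ; B-succ = λ v eq v≢t → let (f , eq′ , w) = first-edge (from-B eq) v≢t in f , eq′ , to-B w
    ; ¬A→N = ¬A→N
    ; ¬N→B = ¬N→B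
    ; ι = ι ; ι-injective = inj
    ; ι-src = λ i → to-A (proj₁ (cut-edge (S⊆C (ι∈S i))))
    ; ι-tgt = λ i → to-B (proj₂ (cut-edge (S⊆C (ι∈S i)))) }
    where
    -- An edge leaving A either lies in `C`, and then ends in B by `cut-edge`, or prolongs a walk
    -- avoiding `C` and so ends in A. Edges entering B are dual.
    ¬A→N : ∀ f → c (src G f) ≡ A → c (tgt G f) ≢ N
    ¬A→N f eq with f ∈? C
    ... | yes f∈C = distinct (λ ()) (to-B (proj₂ (cut-edge f∈C)))
    ... | no  f∉C = distinct (λ ()) (to-A (from-A eq ◅◅ (f , f∉C , refl , refl) ◅ ε))
    ¬N→B : ∀ f → c (tgt G f) ≡ B → c (src G f) ≢ N
    ¬N→B f eq with f ∈? C
    ... | yes f∈C = distinct (λ ()) (to-A (proj₁ (cut-edge f∈C)))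
    ... | no  f∉C = distinct (λ ()) (to-B ((f , f∉C , refl , refl) ◅ from-B eq))

-- Distinct proofs of f ≢ e are definitionally equal, because ⊥ is.
remove : ∀ {n} (e : Fin n) → ∃ λ m → suc m ≡ n × ((Σ (Fin n) λ f → f ≢ e) ↔ Fin m)
remove {suc m} e = m , refl , mk↔ₛ′
  (λ (f , f≢e) → punchOut (f≢e ∘ sym))
  (λ j → punchIn e j , punchInᵢ≢i e j)
  (λ j → punchOut-punchIn e)
  (λ (f , f≢e) → pair-≡ (punchIn-punchOut (f≢e ∘ sym)))
  where
  pair-≡ : ∀ {f g} {p : f ≢ e} {q : g ≢ e} → f ≡ g → (f , p) ≡ (g , q)
  pair-≡ refl = refl

-- Explicit deletions and contractions

module _ (G : Graph) (e : Fin (nE G)) where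

  private
    others : (Σ (Fin (nE G)) λ f → f ≢ e) ↔ Fin (proj₁ (remove e))
    others = proj₂ (proj₂ (remove e))

  -- Serves both reductions: `id` gives the deletion of `e`, `merge` its contraction.
  quotient : ∀ {n} → (Fin (nV G) → Fin n) → Graph
  quotient φ = record
    { nV = _ ; nE = proj₁ (remove e)
    ; src = φ ∘ src G ∘ proj₁ ∘ Inverse.from others
    ; tgt = φ ∘ tgt G ∘ proj₁ ∘ Inverse.from others
    ; s = φ (s G) ; t = φ (t G) }

  quotient-reduct : ∀ {n} (φ : Fin (nV G) → Fin n) → Reduct G (quotient φ) e φ
  quotient-reduct φ = record
    { ψ = others
    ; src-ψ = λ f → cong (φ ∘ src G ∘ proj₁) (Inverse.strictlyInverseʳ others f)
    ; tgt-ψ = λ f → cong (φ ∘ tgt G ∘ proj₁) (Inverse.strictlyInverseʳ others f)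
    ; s-φ = refl ; t-φ = refl }

  quotient-nE : ∀ {n} (φ : Fin (nV G) → Fin n) → suc (nE (quotient φ)) ≡ nE G
  quotient-nE φ = proj₁ (proj₂ (remove e))

  deleted : Graph
  deleted = quotient id

  deleted-deletion : Deletion G deleted e
  deleted-deletion = ↔-id _ , quotient-reduct id

  module _ (a≢b : src G e ≢ tgt G e) where

    private
      a b : Fin (nV G)
      a = src G e
      b = tgt G e

      kept : (Σ (Fin (nV G)) λ v → v ≢ b) ↔ Fin (proj₁ (remove b))
      kept = proj₂ (proj₂ (remove b))

    -- The merged vertex is represented by the tail of `e`, so a colouring pulled back along `rep`
    -- gives it the colour of the tail.
    rep : Fin (proj₁ (remove b)) → Fin (nV G)
    rep y = proj₁ (Inverse.from kept y)

    rep≢b : ∀ y → rep y ≢ tgt G e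
    rep≢b y = proj₂ (Inverse.from kept y)

    merge : Fin (nV G) → Fin (proj₁ (remove b))
    merge x with x ≟ b
    ... | yes _   = Inverse.to kept (a , a≢b)
    ... | no  x≢b = Inverse.to kept (x , x≢b)

    rep-merge : ∀ {x} → x ≢ tgt G e → rep (merge x) ≡ x
    rep-merge {x} x≢b with x ≟ b
    ... | yes x≡b  = contradiction x≡b x≢b
    ... | no  _    = cong proj₁ (Inverse.strictlyInverseʳ kept _)

    rep-merge-b : rep (merge (tgt G e)) ≡ src G e
    rep-merge-b with b ≟ b
    ... | yes _   = cong proj₁ (Inverse.strictlyInverseʳ kept _)
    ... | no  b≢b = contradiction refl b≢b

    merge-rep : ∀ y → merge (rep y) ≡ y
    merge-rep y with rep y ≟ b
    ... | yes eq = contradiction eq (rep≢b y)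
    ... | no  _  = Inverse.strictlyInverseˡ kept y

    merge-a≡merge-b : merge (src G e) ≡ merge (tgt G e)
    merge-a≡merge-b = trans (cong merge (sym rep-merge-b)) (merge-rep _)

    contracted : Graph
    contracted = quotient merge

    contracted-contraction : Contraction G contracted e
    contracted-contraction = merge , (λ y → rep y , merge-rep y) ,
      (λ x y → mk⇔ (kernel x y) λ where
        (inj₁ refl)                 → refl
        (inj₂ (inj₁ (refl , refl))) → merge-a≡merge-b
        (inj₂ (inj₂ (refl , refl))) → sym merge-a≡merge-b) ,
      quotient-reduct merge
      where
      kernel : ∀ x y → merge x ≡ merge y → x ≡ y ⊎ (x ≡ a × y ≡ b) ⊎ (x ≡ b × y ≡ a)
      kernel x y eq = case (x ≟ b) (y ≟ b)
        where
        case : Dec (x ≡ b) → Dec (y ≡ b) → x ≡ y ⊎ (x ≡ a × y ≡ b) ⊎ (x ≡ b × y ≡ a)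
        case (yes refl) (yes refl) = inj₁ refl
        case (yes refl) (no y≢b)   = inj₂ (inj₂
          (refl , trans (sym (rep-merge y≢b)) (trans (cong rep (sym eq)) rep-merge-b)))
        case (no x≢b)   (yes refl) = inj₂ (inj₁
          (trans (sym (rep-merge x≢b)) (trans (cong rep eq) rep-merge-b) , refl))
        case (no x≢b)   (no y≢b)   = inj₁
          (trans (sym (rep-merge x≢b)) (trans (cong rep eq) (rep-merge y≢b)))

-- Reductions that preserve a colouring

module _ (p : Proper G) (C : Coloured G k) (e : Fin (nE G)) where
  open Coloured C

  -- As its head is outside B, `e` is neither an `ι i` nor a `B-succ` witness; it can only be an
  -- `A-pred` witness, and `other` replaces it.
  coloured-deleted : c (tgt G e) ≢ B →
    (c (tgt G e) ≡ A → ∃ λ g → g ≢ e × tgt G g ≡ tgt G e × c (src G g) ≡ A) →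
    Coloured (deleted G e) k
  coloured-deleted ≢B other = record
    { c = c ; c-s = c-s ; c-t = c-t
    ; A-pred = A-pred′
    ; B-succ = B-succ′
    ; ¬A→N = λ h → ¬A→N (old r h) ; ¬N→B = λ h → ¬N→B (old r h)
    ; ι = λ i → new r (ι i) (ι≢e i)
    ; ι-injective = λ eq → ι-injective (new-injective r _ _ eq)
    ; ι-src = λ i → trans (cong c (Reduct.src-ψ r _)) (ι-src i)
    ; ι-tgt = λ i → trans (cong c (Reduct.tgt-ψ r _)) (ι-tgt i) }
    where
    r : Reduct G (deleted G e) e id
    r = quotient-reduct G e id
    ι≢e : ∀ i → ι i ≢ e
    ι≢e i refl = ≢B (ι-tgt i)
    A-pred′ : ∀ v → c v ≡ A → v ≢ s G →
              ∃ λ h → tgt (deleted G e) h ≡ v × c (src (deleted G e) h) ≡ A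
    A-pred′ v cv v≢s with A-pred v cv v≢s
    ... | f , refl , cf with f ≟ e
    ...   | no f≢e = new r f f≢e , Reduct.tgt-ψ r _ , trans (cong c (Reduct.src-ψ r _)) cf
    ...   | yes refl with other cv
    ...     | g , g≢e , eq , cg =
      new r g g≢e , trans (Reduct.tgt-ψ r _) eq , trans (cong c (Reduct.src-ψ r _)) cg
    B-succ′ : ∀ v → c v ≡ B → v ≢ t G →
              ∃ λ h → src (deleted G e) h ≡ v × c (tgt (deleted G e) h) ≡ B
    B-succ′ v cv v≢t with B-succ v cv v≢t
    ... | f , refl , cf = new r f (λ { refl → ≢B cf }) ,
                          Reduct.src-ψ r _ , trans (cong c (Reduct.tgt-ψ r _)) cf

  module _ (only : ∀ f → tgt G f ≡ tgt G e → f ≡ e)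
           (colours : (c (tgt G e) ≡ A × c (src G e) ≡ A) ⊎ (c (tgt G e) ≡ N × c (src G e) ≡ B)) where

    private
      a≢b : src G e ≢ tgt G e
      a≢b = no-loop p e
      φ = merge G e a≢b
      K = contracted G e a≢b
      c′ : Fin (nV K) → Side
      c′ = c ∘ rep G e a≢b
      r : Reduct G K e φ
      r = quotient-reduct G e φ

      same : ∀ {x} → x ≢ tgt G e → c′ (φ x) ≡ c x
      same x≢b = cong c (rep-merge G e a≢b x≢b)

      same-b : c′ (φ (tgt G e)) ≡ c (src G e)
      same-b = cong c (rep-merge-b G e a≢b)

      same-tgt : ∀ {f} → f ≢ e → c′ (φ (tgt G f)) ≡ c (tgt G f)
      same-tgt f≢e = same (f≢e ∘ only _)

      split-at-b : (P : Pred (Fin (nV G)) 0ℓ) → (∀ {x} → x ≢ tgt G e → P x) → P (tgt G e) → ∀ {x} → P x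
      split-at-b P away at {x} with x ≟ tgt G e
      ... | no x≢b   = away x≢b
      ... | yes refl = at

      -- Only the head of `e` can change colour, namely from N to B. So A is never lost, and neither
      -- A nor N is gained.
      keep-A : ∀ {x} → c x ≡ A → c′ (φ x) ≡ A
      keep-A = split-at-b (λ x → c x ≡ A → c′ (φ x) ≡ A) (λ x≢b cx → trans (same x≢b) cx) λ cb →
        [ (λ (_ , ca) → trans same-b ca) , (λ (cb′ , _) → case trans (sym cb′) cb of λ ()) ]′ colours

      back-A : ∀ {x} → c′ (φ x) ≡ A → c x ≡ A
      back-A = split-at-b (λ x → c′ (φ x) ≡ A → c x ≡ A) (λ x≢b cx → trans (sym (same x≢b)) cx) λ cb →
        [ proj₁ , (λ (_ , ca) → case trans (sym ca) (trans (sym same-b) cb) of λ ()) ]′ colours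

      back-N : ∀ {x} → c′ (φ x) ≡ N → c x ≡ N
      back-N = split-at-b (λ x → c′ (φ x) ≡ N → c x ≡ N) (λ x≢b cx → trans (sym (same x≢b)) cx) λ cb →
        [ (λ (_ , ca) → case trans (sym ca) (trans (sym same-b) cb) of λ ()) , proj₁ ]′ colours

      b≢B : c (tgt G e) ≢ B
      b≢B cb = [ (λ (cb′ , _) → case trans (sym cb′) cb of λ ()) ,
                 (λ (cb′ , _) → case trans (sym cb′) cb of λ ()) ]′ colours

      rep-≢ : ∀ {x y} → y ≢ φ x → rep G e a≢b y ≢ x
      rep-≢ y≢ eq = y≢ (trans (sym (merge-rep G e a≢b _)) (cong φ eq))

      A-pred′ : ∀ y → c′ y ≡ A → y ≢ φ (s G) → ∃ λ h → tgt K h ≡ y × c′ (src K h) ≡ A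
      A-pred′ y cy y≢s with A-pred (rep G e a≢b y) cy (rep-≢ y≢s)
      ... | f , eq , cf = new r f (λ { refl → rep≢b G e a≢b y (sym eq) }) ,
        trans (Reduct.tgt-ψ r _) (trans (cong φ eq) (merge-rep G e a≢b y)) ,
        trans (cong c′ (Reduct.src-ψ r _)) (keep-A cf)

      B-succ′ : ∀ y → c′ y ≡ B → y ≢ φ (t G) → ∃ λ h → src K h ≡ y × c′ (tgt K h) ≡ B
      B-succ′ y cy y≢t with B-succ (rep G e a≢b y) cy (rep-≢ y≢t)
      ... | f , eq , cf = new r f f≢e ,
        trans (Reduct.src-ψ r _) (trans (cong φ eq) (merge-rep G e a≢b y)) ,
        trans (cong c′ (Reduct.tgt-ψ r _)) (trans (same-tgt f≢e) cf)
        where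
        f≢e : f ≢ e
        f≢e refl = b≢B cf

      ι≢e : ∀ i → ι i ≢ e
      ι≢e i refl = b≢B (ι-tgt i)

    -- Where the head of `e` turns from N to B, its only in-edge is the contracted one, so no edge
    -- from N into B arises; its out-edges now leave B and are unrestricted.
    coloured-contracted : Coloured K k
    coloured-contracted = record
      { c = c′
      ; c-s = keep-A c-s
      ; c-t = trans (same (λ { eq → b≢B (trans (cong c (sym eq)) c-t) })) c-t
      ; A-pred = A-pred′
      ; B-succ = B-succ′
      ; ¬A→N = λ h ca cn → ¬A→N (old r h) (back-A ca) (back-N cn)
      ; ¬N→B = λ h cb cn → ¬N→B (old r h)
          (trans (sym (same-tgt (old≢e r h))) cb) (back-N cn)
      ; ι = λ i → new r (ι i) (ι≢e i)
      ; ι-injective = λ eq → ι-injective (new-injective r _ _ eq)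
      ; ι-src = λ i → trans (cong c′ (Reduct.src-ψ r _)) (keep-A (ι-src i))
      ; ι-tgt = λ i → trans (cong c′ (Reduct.tgt-ψ r _)) (trans (same-tgt (ι≢e i)) (ι-tgt i)) }

-- The last component makes the number of edges a termination measure.
Reducible : Graph → ℕ → Set
Reducible G k = ∃ λ H → DStep G H × Coloured H k × suc (nE H) ≡ nE G

-- A vertex v ∉ B ∪ {s} all of whose predecessors lie in B ∪ {s} has a unique incoming edge, which
-- is contracted, or a superfluous one, which is deleted: its tail is s or has a further edge into B.
advance : Proper G → (C : Coloured G k) →
          Reducible G k ⊎ (∀ v → v ≢ s G → Coloured.c C v ≡ B)
advance {G} {k} p C = result
  where
  open Coloured C
  Outside : Pred (Fin (nV G)) 0ℓ
  Outside v = v ≢ s G × c v ≢ B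

  outside? : Decidable Outside
  outside? v = ¬? (v ≟ s G) ×-dec ¬? (c v ≟ˢ B)

  -- No edge leaves `t`, so the tail differs from `t` and `B-succ` gives it an edge into B, which
  -- cannot be `f`.
  B⇒outdeg≥2 : ∀ {f} → c (src G f) ≡ B → c (tgt G f) ≢ B → 2 ≤ outdeg G (src G f)
  B⇒outdeg≥2 {f} cf f≢B with B-succ (src G f) cf (no-edge-from-sink p f)
  ... | h , eq , ch = count≥2 (λ g → src G g ≟ src G f) eq refl λ { refl → f≢B ch }

  -- `g` serves twice: as the second in-edge that deletion requires, and as the replacement for `f`
  -- in `A-pred`.
  delete : ∀ g f → g ≢ f → tgt G g ≡ tgt G f → c (tgt G f) ≢ B → 2 ≤ outdeg G (src G f) →
           (c (tgt G f) ≡ A → c (src G g) ≡ A) → Reducible G k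
  delete g f g≢f eq ≢B 2≤out A⇒A = deleted G f ,
    deletion f 2≤out (count≥2 (λ h → tgt G h ≟ tgt G f) eq refl g≢f) (deleted-deletion G f) ,
    coloured-deleted p C f ≢B (λ ca → g , g≢f , eq , A⇒A ca) ,
    quotient-nE G f id

  contract : ∀ g → (∀ f → tgt G f ≡ tgt G g → f ≡ g) →
             (c (tgt G g) ≡ A × c (src G g) ≡ A) ⊎ (c (tgt G g) ≡ N × c (src G g) ≡ B) → Reducible G k
  contract g only colours = contracted G g (no-loop p g) ,
    backward g (unique⇒count≡1 (λ f → tgt G f ≟ tgt G g) refl only)
      (contracted-contraction G g (no-loop p g)) ,
    coloured-contracted p C g only colours ,
    quotient-nE G g (merge G g (no-loop p g))

  another? : ∀ g → Dec (∃ λ f → g ≢ f × tgt G g ≡ tgt G f)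
  another? g = any? λ f → ¬? (g ≟ f) ×-dec (tgt G g ≟ tgt G f)

  none⇒only : ∀ {g} → ¬ (∃ λ f → g ≢ f × tgt G g ≡ tgt G f) → ∀ f → tgt G f ≡ tgt G g → f ≡ g
  none⇒only {g} none f eq with g ≟ f
  ... | yes refl = refl
  ... | no  g≢f  = contradiction (f , g≢f , sym eq) none

  predecessor : ∀ f → ¬ Outside (src G f) → src G f ≡ s G ⊎ c (src G f) ≡ B
  predecessor f ¬out with src G f ≟ s G | c (src G f) ≟ˢ B
  ... | yes eq | _      = inj₁ eq
  ... | no _   | yes eq = inj₂ eq
  ... | no ≢s  | no ≢B  = contradiction (≢s , ≢B) ¬out

  module _ (v : Fin (nV G)) (v≢s : v ≢ s G) (v≢B : c v ≢ B)
           (preds : ∀ f → tgt G f ≡ v → src G f ≡ s G ⊎ c (src G f) ≡ B) where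

    reduce-A : c v ≡ A → Reducible G k
    reduce-A cv with A-pred v cv v≢s
    ... | g , refl , cg with another? g
    ...   | no none = contract g (none⇒only none) (inj₁ (cv , cg))
    ...   | yes (f , g≢f , eq) =
      delete g f g≢f eq (subst (λ x → c x ≢ B) eq v≢B) out (λ _ → cg)
      where
      out : 2 ≤ outdeg G (src G f)
      -- `g` starts in A, hence at `s`. If `f` also starts at `s`, then `g` is the second out-edge;
      -- if it starts in B, there is a further edge into B.
      out with preds g refl | preds f (sym eq)
      ... | inj₂ cg′ | _ = contradiction (trans (sym cg′) cg) λ ()
      ... | inj₁ gs | inj₁ f-s = count≥2 (λ h → src G h ≟ src G f) (trans gs (sym f-s)) refl g≢f
      ... | inj₁ gs | inj₂ cf = B⇒outdeg≥2 cf (subst (λ x → c x ≢ B) eq v≢B)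

    -- No predecessor of `v` is `s`, since edges from A to N are excluded; so all of them lie in B.
    reduce-N : c v ≡ N → Reducible G k
    reduce-N cv with Proper.in-edge p v v≢s
    ... | g , refl with another? g
    ...   | no none = contract g (none⇒only none) (inj₂ (cv , pred-B g refl))
      where
      pred-B : ∀ f → tgt G f ≡ v → c (src G f) ≡ B
      pred-B f eq with preds f eq
      ... | inj₂ cf = cf
      ... | inj₁ f-s = contradiction (trans (cong c eq) cv) (¬A→N f (trans (cong c f-s) c-s))
    ...   | yes (f , g≢f , eq) =
      delete g f g≢f eq (subst (λ x → c x ≢ B) eq v≢B) out
        (λ ca → contradiction (trans (sym ca) (trans (cong c (sym eq)) cv)) λ ())
      where
      out : 2 ≤ outdeg G (src G f)
      out with preds f (sym eq)
      ... | inj₂ cf = B⇒outdeg≥2 cf (subst (λ x → c x ≢ B) eq v≢B)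
      ... | inj₁ f-s = contradiction (trans (cong c (sym eq)) cv) (¬A→N f (trans (cong c f-s) c-s))

    reduce : Reducible G k
    reduce = by-side (c v) refl
      where
      by-side : ∀ x → c v ≡ x → Reducible G k
      by-side A = reduce-A
      by-side N = reduce-N
      by-side B cv = contradiction cv v≢B

  result : Reducible G k ⊎ (∀ v → v ≢ s G → c v ≡ B)
  result with any? outside?
  ... | yes (v₀ , out₀) with minimal p outside? v₀ out₀
  ...   | v , (v≢s , v≢B) , preds =
    inj₁ (reduce v v≢s v≢B (λ f eq → predecessor f (preds f eq)))
  result | no none = inj₂ λ v v≢s → all-B v v≢s
    where
    all-B : ∀ v → v ≢ s G → c v ≡ B
    all-B v v≢s with c v ≟ˢ B
    ... | yes eq = eq
    ... | no ≢B  = contradiction (v , v≢s , ≢B) none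

-- Bundles of parallel edges

record Bundle (G : Graph) : Set where
  field
    s≢t    : s G ≢ t G
    covers : ∀ v → v ≢ s G → v ≡ t G
    src≡s  : ∀ f → src G f ≡ s G
    tgt≡t  : ∀ f → tgt G f ≡ t G

bundle-iso : Bundle G → Iso G (GP (nE G))
bundle-iso {G} b = record
  { φ = mk↔ₛ′ to from to-from from-to
  ; ψ = ↔-id _
  ; src-ψ = λ f → sym (trans (cong to (src≡s f)) to-s)
  ; tgt-ψ = λ f → sym (trans (cong to (tgt≡t f)) to-t)
  ; s-φ = to-s ; t-φ = to-t }
  where
  open Bundle b
  to : Fin (nV G) → Fin 2
  to v with v ≟ s G
  ... | yes _ = fz
  ... | no  _ = fs fz
  from : Fin 2 → Fin (nV G)
  from fz     = s G
  from (fs _) = t G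
  to-s : to (s G) ≡ fz
  to-s with s G ≟ s G
  ... | yes _ = refl
  ... | no ≢s = contradiction refl ≢s
  to-t : to (t G) ≡ fs fz
  to-t with t G ≟ s G
  ... | yes eq = contradiction (sym eq) s≢t
  ... | no _ = refl
  to-from : ∀ y → to (from y) ≡ y
  to-from fz      = to-s
  to-from (fs fz) = to-t
  from-to : ∀ v → from (to v) ≡ v
  from-to v with v ≟ s G
  ... | yes eq = sym eq
  ... | no ≢s  = sym (covers v ≢s)

bundle-deleted : ∀ e → Bundle G → Bundle (deleted G e)
bundle-deleted {G} e b = record
  { s≢t = s≢t ; covers = covers ; src≡s = λ h → src≡s (old r h) ; tgt≡t = λ h → tgt≡t (old r h) }
  where
  open Bundle b
  r = quotient-reduct G e id

-- `d` counts the surplus edges, which are deleted one by one; `2 ≤ k` guarantees two parallel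
-- edges, so the degree conditions hold.
bundle-minor : ∀ d → nE G ≡ d + k → 2 ≤ k → Bundle G → DMinor (GP k) G
bundle-minor {G} zero refl 2≤k b = G , ε , bundle-iso b
bundle-minor {G} {k} (suc d) eq 2≤k b =
  let (H , steps , iso) = bundle-minor d (ℕ.suc-injective (trans (quotient-nE G e₀ id) eq)) 2≤k
                            (bundle-deleted e₀ b)
  in H , step ◅ steps , iso
  where
  open Bundle b
  2≤nE : 2 ≤ nE G
  2≤nE = subst (2 ≤_) (sym eq) (ℕ.≤-trans 2≤k (ℕ.m≤n+m k (suc d)))
  e₀ e₁ : Fin (nE G)
  e₀ = fromℕ< (ℕ.<-trans (s≤s z≤n) 2≤nE)
  e₁ = fromℕ< 2≤nE
  e₀≢e₁ : e₀ ≢ e₁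
  e₀≢e₁ eq with trans (sym (toℕ-fromℕ< _)) (trans (cong toℕ eq) (toℕ-fromℕ< 2≤nE))
  ... | ()
  step : DStep G (deleted G e₀)
  step = deletion e₀
    (count≥2 (λ f → src G f ≟ src G e₀) refl (trans (src≡s e₁) (sym (src≡s e₀))) e₀≢e₁)
    (count≥2 (λ f → tgt G f ≟ tgt G e₀) refl (trans (tgt≡t e₁) (sym (tgt≡t e₀))) e₀≢e₁)
    (deleted-deletion G e₀)

-- A vertex other than `s` and `t` would be coloured both A and B, and no edge enters `s` or leaves
-- `t`.
bundle : Proper G → (C : Coloured G k) → let open Coloured C in
         (∀ v → v ≢ s G → c v ≡ B) → (∀ v → v ≢ t G → c v ≡ A) → Bundle G
bundle {G} p C all-B all-A = record
  { s≢t = s≢t ; covers = covers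
  ; src≡s = λ f → source (src G f) (no-edge-from-sink p f)
  ; tgt≡t = λ f → covers (tgt G f) (no-edge-into-source p f) }
  where
  open Coloured C
  s≢t : s G ≢ t G
  s≢t eq = contradiction (trans (sym c-s) (trans (cong c eq) c-t)) λ ()
  covers : ∀ v → v ≢ s G → v ≡ t G
  covers v v≢s with v ≟ t G
  ... | yes eq = eq
  ... | no v≢t = contradiction (trans (sym (all-B v v≢s)) (all-A v v≢t)) λ ()
  source : ∀ v → v ≢ t G → v ≡ s G
  source v v≢t with v ≟ s G
  ... | yes eq = eq
  ... | no v≢s = contradiction (covers v v≢s) v≢t

reduce-or-bundle : Proper G → Coloured G k → Reducible G k ⊎ Bundle G
reduce-or-bundle p C with advance p C | advance (op-proper p) (op-coloured C)
... | inj₁ reduced | _ = inj₁ reduced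
-- `op (op G)` is definitionally `G`, so a reduction of the dual turns back into one of `G`.
... | inj₂ _ | inj₁ (H , st , C′ , eq) = inj₁ (op H , op-step st , op-coloured C′ , eq)
... | inj₂ all-B | inj₂ all-A = inj₂ (bundle p C all-B λ v v≢t → flip-side-B (all-A v v≢t))

coloured-minor : ∀ n → nE G ≡ n → 2 ≤ k → Proper G → Coloured G k → DMinor (GP k) G
coloured-minor n eq 2≤k p C with reduce-or-bundle p C
-- Injectivity of `ι` gives `k ≤ nE G`, so the surplus is `nE G ∸ k`.
... | inj₂ b = bundle-minor _ (sym (ℕ.m∸n+n≡m (injective⇒≤ (Coloured.ι-injective C)))) 2≤k b
coloured-minor zero    eq 2≤k p C | inj₁ (H , st , C′ , eq′) with () ← trans eq′ eq
coloured-minor (suc n) eq 2≤k p C | inj₁ (H , st , C′ , eq′)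
  with coloured-minor n (ℕ.suc-injective (trans eq′ eq)) 2≤k (step-proper st p) C′
... | K , steps , iso = K , st ◅ steps , iso

theorem22 : (G : Graph) → TDAG G → (k : ℕ) → 2 ≤ k → PW≥ G k ⇔ DMinor (GP k) G
theorem22 G tdag k 2≤k = mk⇔
  (λ (S , (C , min , S⊆C) , k≤) → coloured-minor (nE G) refl 2≤k p (parallel⇒coloured p min S⊆C k≤))
  (λ minor → separated⇒PW≥ p (minor-separated p minor))
  where
  p : Proper G
  p = TDAG⇒proper tdag
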